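{- There exists a reasonably-balanced Boolean function (family) $f:\{0,1\}^n\to\{0,1\}$, computable by a depth-three $\mathsf{AC}^0$ circuit, such that $$\overline{\mathrm{bs}}_0(f)=\Omega\left(\frac{n}{\log n}\right)\quad\text{and}\quad \overline{\mathrm{bs}}_1(f)=\Omega\left(\frac{n}{\log n}\right).$$
   Context: Here $f$ stands for a family $f=f_n$ of Boolean functions on $n$ bits, and asymptotic notation is as $n\to\infty$. Circuits. $\mathsf{AC}^0$ circuits are circuits of AND, OR, and NOT gates with unbounded fanin, constant depth and size $n^{O(1)}$; depth is the number of alternating layers of AND and OR gates (NOT gates are not counted). Reasonably-balanced. $f$ is reasonably-balanced if there exist constants $a,b\in(0,1)$ such that $a\le \mathrm{E}_{X\in\{0,1\}^n}[f(X)]\le b$ for every $n$ ($X$ uniform). Block-sensitivity. For $X\in\{0,1\}^n$ and $B\subseteq[n]$ (a block), $X^B$ denotes $X$ with the bits in $B$ flipped. The block-sensitivity $\mathrm{bs}_X(f)$ is the largest $k$ for which there exist $k$ pairwise-disjoint blocks $B_1,\ldots,B_k$ such that $f(X^{B_i})\ne f(X)$ for all $i\in[k]$. For non-constant $f$ and $b\in\{0,1\}$, the average $b$-block-sensitivity is $$\overline{\mathrm{bs}}_b(f):=\mathop{\mathrm{E}}_{X\in\{0,1\}^n\,:\,f(X)=b}\left[\mathrm{bs}_X(f)\right],$$ with $X$ uniform over $f^{ -1}(b)$. -}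

module Defs where

open import Data.Bool.Base using (Bool; true; false; not; _xor_; if_then_else_)
open import Data.Bool.ListAction using (and; or)
import Data.Bool.Properties as Bool
open import Data.Empty using (⊥-elim)
open import Data.Fin.Base using (Fin)
import Data.Fin.Properties as Fin
open import Data.Fin.Subset using (Subset; _∩_; Empty; Nonempty; _∈_; ⊥)
open import Data.Fin.Subset.Properties
  using (anySubset?; nonempty?; Empty-unique; x∈p∩q⁺)
open import Data.Integer.Base using (+_)
open import Data.List.Base using (List; []; _∷_; _++_; map; filter; foldr; length)
open import Data.Nat.Base using (ℕ; zero; suc; _+_; _⊔_; _^_; _≤_; _≥_; s≤s)
open import Data.Nat.ListAction using (sum)
open import Data.Nat.Logarithm using (⌊log₂_⌋)
import Data.Nat.Properties as ℕ
open import Data.Product.Base using (Σ; ∃-syntax; _×_; _,_; proj₁; proj₂)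
open import Data.Rational.Base as ℚ using (ℚ; 0ℚ; 1ℚ)
open import Data.Sum.Base using (inj₁; inj₂)
open import Data.Vec.Base using (Vec; []; _∷_; lookup; zipWith; replicate)
open import Relation.Binary.PropositionalEquality
  using (_≡_; _≢_; refl; sym; trans; cong; cong₂; subst)
open import Relation.Nullary using (Dec; yes; no)
open import Relation.Nullary.Decidable using (¬?; _×-dec_; _→-dec_; map′)

BoolFun : ℕ → Set
BoolFun n = Vec Bool n → Bool

Family : Set
Family = ∀ n → BoolFun n

-- m / 0 is taken to be 0.
ratio : ℕ → ℕ → ℚ
ratio m zero    = 0ℚ
ratio m (suc d) = + m ℚ./ suc d

cube : ∀ n → List (Vec Bool n)
cube zero    = [] ∷ []
cube (suc n) = map (false ∷_) (cube n) ++ map (true ∷_) (cube n)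

-- The expectation of g at a uniformly chosen entry of a list.
𝔼 : ∀ {A : Set} → List A → (A → ℕ) → ℚ
𝔼 xs g = ratio (sum (map g xs)) (length xs)

fibre : ∀ {n} → BoolFun n → Bool → List (Vec Bool n)
fibre {n} f b = filter (λ X → f X Bool.≟ b) (cube n)

mean : ∀ {n} → BoolFun n → ℚ
mean {n} f = 𝔼 (cube n) (λ X → if f X then 1 else 0)

-- n = 0 is excluded because every function on zero bits has mean 0 or 1.
ReasonablyBalanced : Family → Set
ReasonablyBalanced f =
  ∃[ a ] ∃[ b ]
    (0ℚ ℚ.< a × a ℚ.< 1ℚ) × (0ℚ ℚ.< b × b ℚ.< 1ℚ) ×
    (∀ n → n ≥ 1 → a ℚ.≤ mean (f n) × mean (f n) ℚ.≤ b)

infixl 8 _^^_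

_^^_ : ∀ {n} → Vec Bool n → Subset n → Vec Bool n
X ^^ B = zipWith _xor_ X B

SensitiveBlocks : ∀ {n} → BoolFun n → Vec Bool n → ∀ {k} → Vec (Subset n) k → Set
SensitiveBlocks f X {k} Bs =
  (∀ (i j : Fin k) → i ≢ j → Empty (lookup Bs i ∩ lookup Bs j)) ×
  (∀ (i : Fin k) → f (X ^^ lookup Bs i) ≢ f X)

HasSensitiveBlocks : ∀ {n} → BoolFun n → Vec Bool n → ℕ → Set
HasSensitiveBlocks {n} f X k = Σ (Vec (Subset n) k) (SensitiveBlocks f X)

sensitiveBlocks? : ∀ {n} (f : BoolFun n) X {k} (Bs : Vec (Subset n) k) →
                   Dec (SensitiveBlocks f X Bs)
sensitiveBlocks? f X Bs =
  Fin.all? (λ i → Fin.all? (λ j →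
    ¬? (i Fin.≟ j) →-dec ¬? (nonempty? (lookup Bs i ∩ lookup Bs j))))
  ×-dec
  Fin.all? (λ i → ¬? (f (X ^^ lookup Bs i) Bool.≟ f X))

anySubsets? : ∀ {n} k {P : Vec (Subset n) k → Set} → (∀ Bs → Dec (P Bs)) →
              Dec (Σ (Vec (Subset n) k) P)
anySubsets? zero    P? = map′ (λ p → [] , p) (λ { ([] , p) → p }) (P? [])
anySubsets? (suc k) P? =
  map′ (λ { (B , Bs , p) → B ∷ Bs , p }) (λ { (B ∷ Bs , p) → B , Bs , p })
       (anySubset? (λ B → anySubsets? k (λ Bs → P? (B ∷ Bs))))

hasSensitiveBlocks? : ∀ {n} (f : BoolFun n) X k → Dec (HasSensitiveBlocks f X k)
hasSensitiveBlocks? f X k = anySubsets? k (sensitiveBlocks? f X)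

-- The largest k ≤ m satisfying P (0 if there is none).
largest : ∀ {P : ℕ → Set} → (∀ k → Dec (P k)) → ℕ → ℕ
largest P? zero    = zero
largest P? (suc m) with P? (suc m)
... | yes _ = suc m
... | no  _ = largest P? m

-- The cut-off at n loses nothing: sensitive blocks are nonempty and disjoint,
-- so there are at most n of them (see bs-attained and bs-maximal).
bs : ∀ {n} → BoolFun n → Vec Bool n → ℕ
bs {n} f X = largest (hasSensitiveBlocks? f X) n

avgBs : Bool → ∀ {n} → BoolFun n → ℚ
avgBs b f = 𝔼 (fibre f b) (bs f)

private
  largest-attained : ∀ {P : ℕ → Set} (P? : ∀ k → Dec (P k)) → P 0 →
                     ∀ m → P (largest P? m)
  largest-attained P? p₀ zero    = p₀
  largest-attained P? p₀ (suc m) with P? (suc m)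
  ... | yes p = p
  ... | no  _ = largest-attained P? p₀ m

  largest-maximal : ∀ {P : ℕ → Set} (P? : ∀ k → Dec (P k)) →
                    ∀ m {k} → k ≤ m → P k → k ≤ largest P? m
  largest-maximal P? zero    k≤0 _ = k≤0
  largest-maximal P? (suc m) k≤1+m p with P? (suc m)
  ... | yes _ = k≤1+m
  ... | no ¬p with ℕ.m≤n⇒m<n∨m≡n k≤1+m
  ...   | inj₁ (s≤s k≤m) = largest-maximal P? m k≤m p
  ...   | inj₂ refl      = ⊥-elim (¬p p)

  ^^-⊥ : ∀ {n} (X : Vec Bool n) → X ^^ ⊥ ≡ X
  ^^-⊥ []      = refl
  ^^-⊥ (x ∷ X) = cong₂ _∷_ (Bool.xor-identityʳ x) (^^-⊥ X)

  sensitive⇒nonempty : ∀ {n} (f : BoolFun n) X B → f (X ^^ B) ≢ f X → Nonempty B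
  sensitive⇒nonempty f X B sens with nonempty? B
  ... | yes ne = ne
  ... | no  ¬ne = ⊥-elim (sens (cong f
          (trans (cong (X ^^_) (Empty-unique ¬ne)) (^^-⊥ X))))

hasSensitiveBlocks⇒≤ : ∀ {n} (f : BoolFun n) X {k} → HasSensitiveBlocks f X k → k ≤ n
hasSensitiveBlocks⇒≤ {n} f X {k} (Bs , disj , sens) =
  Fin.injective⇒≤ {f = λ i → proj₁ (point i)} inj
  where
  point : (i : Fin k) → Nonempty (lookup Bs i)
  point i = sensitive⇒nonempty f X (lookup Bs i) (sens i)

  inj : ∀ {i j} → proj₁ (point i) ≡ proj₁ (point j) → i ≡ j
  inj {i} {j} eq with i Fin.≟ j
  ... | yes i≡j = i≡j
  ... | no  i≢j = ⊥-elim (disj i j i≢j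
          (proj₁ (point i) , x∈p∩q⁺ (proj₂ (point i) ,
            subst (_∈ lookup Bs j) (sym eq) (proj₂ (point j)))))

bs-attained : ∀ {n} (f : BoolFun n) X → HasSensitiveBlocks f X (bs f X)
bs-attained {n} f X =
  largest-attained (hasSensitiveBlocks? f X) ([] , (λ ()) , (λ ())) n

bs-maximal : ∀ {n} (f : BoolFun n) X {k} → HasSensitiveBlocks f X k → k ≤ bs f X
bs-maximal {n} f X h =
  largest-maximal (hasSensitiveBlocks? f X) n (hasSensitiveBlocks⇒≤ f X h) h

data Gate (w : ℕ) : Set where
  AND OR : List (Fin w) → Gate w
  NOT    : Fin w → Gate w

-- Gates n s: an acyclic circuit on n inputs with s gates, listed in
-- topological order.  It carries s + n wires, the most recent gate first and
-- the inputs last; each gate may read any earlier wire.  Fan-in is unbounded,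
-- and a wire repeated in an AND or OR list changes nothing.
data Gates (n : ℕ) : ℕ → Set where
  inputs : Gates n 0
  _▹_    : ∀ {s} → Gates n s → Gate (s + n) → Gates n (suc s)

record Circuit (n : ℕ) : Set where
  constructor circuit
  field
    -- NOT gates are included in the size.
    size   : ℕ
    gates  : Gates n size
    output : Fin (size + n)

open Circuit public using (size)

gateValue : ∀ {w} → Vec Bool w → Gate w → Bool
gateValue v (AND is) = and (map (lookup v) is)
gateValue v (OR  is) = or  (map (lookup v) is)
gateValue v (NOT i)  = not (lookup v i)

wireValues : ∀ {n s} → Gates n s → Vec Bool n → Vec Bool (s + n)
wireValues inputs  X = X
wireValues (C ▹ g) X = gateValue (wireValues C X) g ∷ wireValues C X

eval : ∀ {n} → Circuit n → BoolFun n
eval (circuit _ C o) X = lookup (wireValues C X) o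

gateDepth : ∀ {w} → Vec ℕ w → Gate w → ℕ
gateDepth d (AND is) = suc (foldr _⊔_ 0 (map (lookup d) is))
gateDepth d (OR  is) = suc (foldr _⊔_ 0 (map (lookup d) is))
gateDepth d (NOT i)  = lookup d i

wireDepths : ∀ {n s} → Gates n s → Vec ℕ (s + n)
wireDepths {n} inputs = replicate n 0
wireDepths (C ▹ g)    = gateDepth (wireDepths C) g ∷ wireDepths C

-- The maximal number of AND and OR gates on a path from an input to the
-- output.  This bounds the number of alternating layers: after moving the NOT
-- gates to the inputs, consecutive gates of the same kind can be merged.
depth : ∀ {n} → Circuit n → ℕ
depth (circuit _ C o) = lookup (wireDepths C) o

AC⁰-computable : (d : ℕ) → Family → Set
AC⁰-computable d f =
  Σ (∀ n → Circuit n) λ C →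
    (∀ n X → eval (C n) X ≡ f n X) ×
    (∀ n → depth (C n) ≤ d) ×
    (∃[ k ] ∃[ N ] ∀ n → n ≥ N → size (C n) ≤ n ^ k)

infix 4 _∈Ω_

_∈Ω_ : (ℕ → ℚ) → (ℕ → ℚ) → Set
h ∈Ω g = ∃[ c ] 0ℚ ℚ.< c × (∃[ N ] ∀ n → n ≥ N → c ℚ.* g n ℚ.≤ h n)

-- Rounding changes the logarithm by at most a factor of 2 once n ≥ 2, which
-- does not affect the class Ω(n / log n).
n/log : ℕ → ℚ
n/log n = ratio n ⌊log₂ n ⌋

{-# OPTIONS --safe #-}

-- Let T be an OR of m ANDs on disjoint blocks of w bits, with m·w ≈ n and
-- 2^w > n, and let f(x, Y) = x xor T(Y).  The first bit makes f exactly
-- balanced.  By a union bound T vanishes on at least half of the inputs, and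
-- where T(Y) = 0 each of the m ≈ n / log n blocks can be switched to all ones,
-- which flips T and hence f.  For either value b, at least half of f⁻¹(b)
-- consists of inputs (b, Y) with T(Y) = 0.

module Submission where

open import Defs
open import Data.Bool.Base using (Bool; true; false; not; _∧_; _∨_; _xor_; if_then_else_)
open import Data.Bool.ListAction using (all; any)
import Data.Bool.Properties as Bool
open import Data.Empty using (⊥-elim)
open import Data.Fin.Base using (Fin; zero; suc; _↑ˡ_; _↑ʳ_)
open import Data.Fin.Subset using (Subset; _∩_; Empty; ⊥; ∁)
open import Data.Fin.Subset.Properties using (∉⊥; p∩q⊆p; p∩q⊆q)
import Data.Integer.Base as ℤ
import Data.Integer.Properties as ℤ
open import Data.List.Base as List using (List; []; _∷_; map; filter; foldr; length; allFin)
import Data.List.Properties as List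
open import Data.Nat.Base hiding (_/_; _%_)
open import Data.Nat.DivMod using (_/_; _%_; m≡m%n+[m/n]*n; m%n<n)
open import Data.Nat.ListAction using (sum)
open import Data.Nat.ListAction.Properties using (sum-++)
open import Data.Nat.Logarithm using (⌊log₂_⌋; ⌊log₂⌋-mono-≤; ⌊log₂[2^n]⌋≡n)
open import Data.Nat.Properties
open import Data.Nat.Tactic.RingSolver using (solve-∀)
open import Data.Product.Base using (Σ; _×_; _,_)
open import Data.Rational.Base as ℚ using (½; 0ℚ; 1ℚ)
import Data.Rational.Properties as ℚ
open import Data.Rational.Unnormalised.Base as ℚᵘ using (mkℚᵘ; *≤*)
import Data.Rational.Unnormalised.Properties as ℚᵘ
open import Data.Vec.Base as Vec using (Vec; []; _∷_; _++_; lookup; splitAt; here; there)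
import Data.Vec.Properties as Vec
open import Function.Base using (_∘_)
open import Relation.Binary.PropositionalEquality hiding ([_])
open import Relation.Nullary using (Dec; does; contradiction)
open import Relation.Nullary.Decidable using (from-yes)

-- Sums over the cube and over fibres

∑ : ∀ {n} → (Vec Bool n → ℕ) → ℕ
∑ {n} g = sum (map g (cube n))

𝟙 : Bool → ℕ
𝟙 b = if b then 1 else 0

∑-suc : ∀ {n} (g : Vec Bool (suc n) → ℕ) →
        ∑ g ≡ ∑ (g ∘ (false ∷_)) + ∑ (g ∘ (true ∷_))
∑-suc {n} g = begin
  sum (map g (F List.++ T))            ≡⟨ cong sum (List.map-++ g F T) ⟩
  sum (map g F List.++ map g T)        ≡⟨ sum-++ (map g F) (map g T) ⟩
  sum (map g F) + sum (map g T)        ≡⟨ cong₂ _+_ (cong sum (List.map-∘ (cube n)))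
                                                    (cong sum (List.map-∘ (cube n))) ⟨
  ∑ (g ∘ (false ∷_)) + ∑ (g ∘ (true ∷_)) ∎
  where
  open ≡-Reasoning
  F = map (false ∷_) (cube n)
  T = map (true ∷_) (cube n)

∑-cong : ∀ {n} {g h : Vec Bool n → ℕ} → (∀ X → g X ≡ h X) → ∑ g ≡ ∑ h
∑-cong {n} g≡h = cong sum (List.map-cong g≡h (cube n))

∑-mono : ∀ {n} {g h : Vec Bool n → ℕ} → (∀ X → g X ≤ h X) → ∑ g ≤ ∑ h
∑-mono {n} {g} {h} g≤h = go (cube n)
  where
  go : ∀ xs → sum (map g xs) ≤ sum (map h xs)
  go []       = z≤n
  go (x ∷ xs) = +-mono-≤ (g≤h x) (go xs)

∑-+ : ∀ {n} (g h : Vec Bool n → ℕ) → ∑ (λ X → g X + h X) ≡ ∑ g + ∑ h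
∑-+ {n} g h = go (cube n)
  where
  interchange : ∀ a b c d → a + b + (c + d) ≡ a + c + (b + d)
  interchange = solve-∀

  go : ∀ xs → sum (map (λ X → g X + h X) xs) ≡ sum (map g xs) + sum (map h xs)
  go []       = refl
  go (x ∷ xs) = trans (cong (g x + h x +_) (go xs)) (interchange (g x) (h x) _ _)

∑-* : ∀ {n} m (g : Vec Bool n → ℕ) → ∑ (λ X → m * g X) ≡ m * ∑ g
∑-* {n} m g = go (cube n)
  where
  go : ∀ xs → sum (map (λ X → m * g X) xs) ≡ m * sum (map g xs)
  go []       = sym (*-zeroʳ m)
  go (x ∷ xs) = trans (cong (m * g x +_) (go xs)) (sym (*-distribˡ-+ m (g x) _))

∑-1 : ∀ n → ∑ {n} (λ _ → 1) ≡ 2 ^ n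
∑-1 zero    = refl
∑-1 (suc n) = trans (∑-suc {n} (λ _ → 1))
  (cong₂ _+_ (∑-1 n) (trans (∑-1 n) (sym (+-identityʳ (2 ^ n)))))

length-cube : ∀ n → length (cube n) ≡ 2 ^ n
length-cube n = trans (go (cube n)) (∑-1 n)
  where
  go : ∀ (xs : List (Vec Bool n)) → length xs ≡ sum (map (λ _ → 1) xs)
  go []       = refl
  go (x ∷ xs) = cong suc (go xs)

module _ {n} (f : BoolFun n) (b : Bool) where

  private
    P? : ∀ X → Dec (f X ≡ b)
    P? X = f X Bool.≟ b

  -- Trading the filter for an indicator makes the sum range over the whole cube, where `∑-suc` can
  -- split it by the first bit.
  length-fibre : length (fibre f b) ≡ ∑ (λ X → 𝟙 (does (f X Bool.≟ b)))
  length-fibre = go (cube n)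
    where
    go : ∀ xs → length (filter P? xs) ≡ sum (map (λ X → 𝟙 (does (P? X))) xs)
    go []       = refl
    go (x ∷ xs) with does (P? x)
    ... | true  = cong suc (go xs)
    ... | false = go xs

  sum-fibre : ∀ (g : Vec Bool n → ℕ) →
              sum (map g (fibre f b)) ≡ ∑ (λ X → if does (f X Bool.≟ b) then g X else 0)
  sum-fibre g = go (cube n)
    where
    go : ∀ xs → sum (map g (filter P? xs)) ≡
                sum (map (λ X → if does (P? X) then g X else 0) xs)
    go []       = refl
    go (x ∷ xs) with does (P? x)
    ... | true  = cong (g x +_) (go xs)
    ... | false = go xs

-- An OR of ANDs on disjoint blocks

dnf : ∀ {n} → List (List (Fin n)) → BoolFun n
dnf Bs X = any (all (lookup X)) Bs

-- The recursion makes an input for `suc m` blocks definitionally of length `w + arity w r m`, so it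
-- splits as `P ++ Y` without transport. The last `r` bits lie in no block; they fill up the length.
arity : ℕ → ℕ → ℕ → ℕ
arity w r zero    = r
arity w r (suc m) = w + arity w r m

arity≡ : ∀ w r m → arity w r m ≡ r + m * w
arity≡ w r zero    = sym (+-identityʳ r)
arity≡ w r (suc m) = trans (cong (w +_) (arity≡ w r m)) (swap w r (m * w))
  where
  swap : ∀ a b c → a + (b + c) ≡ b + (a + c)
  swap = solve-∀

blocks : ∀ w r m → List (List (Fin (arity w r m)))
blocks w r zero    = []
blocks w r (suc m) = map (_↑ˡ arity w r m) (allFin w) ∷ map (map (w ↑ʳ_)) (blocks w r m)

tribes : ∀ w r m → BoolFun (arity w r m)
tribes w r m = dnf (blocks w r m)

length-blocks : ∀ w r m → length (blocks w r m) ≡ m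
length-blocks w r zero    = refl
length-blocks w r (suc m) =
  cong suc (trans (List.length-map (map (w ↑ʳ_)) (blocks w r m)) (length-blocks w r m))

allTrue : ∀ {w} → BoolFun w
allTrue {w} P = all (lookup P) (allFin w)

allTrue-∷ : ∀ {w} x (P : Vec Bool w) → allTrue (x ∷ P) ≡ x ∧ allTrue P
allTrue-∷ {w} x P = cong (λ bs → x ∧ foldr _∧_ true bs)
  (trans (List.map-tabulate suc (lookup (x ∷ P)))
         (sym (List.map-tabulate (λ i → i) (lookup P))))

-- A bit vector doubles as the subset of its true positions, so `∁ P` is exactly the set of zeros of
-- `P`, and flipping it leaves only ones.
allTrue-^^-∁ : ∀ {w} (P : Vec Bool w) → allTrue (P ^^ ∁ P) ≡ true
allTrue-^^-∁ []          = refl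
allTrue-^^-∁ (false ∷ P) = trans (allTrue-∷ true (P ^^ ∁ P)) (allTrue-^^-∁ P)
allTrue-^^-∁ (true  ∷ P) = trans (allTrue-∷ true (P ^^ ∁ P)) (allTrue-^^-∁ P)

any-map : ∀ {A B : Set} (p : B → Bool) (q : A → Bool) (h : A → B) →
          (∀ x → p (h x) ≡ q x) → ∀ xs → any p (map h xs) ≡ any q xs
any-map p q h eq xs = cong (foldr _∨_ false)
  (trans (sym (List.map-∘ xs)) (List.map-cong eq xs))

all-map : ∀ {A B : Set} (p : B → Bool) (q : A → Bool) (h : A → B) →
          (∀ x → p (h x) ≡ q x) → ∀ xs → all p (map h xs) ≡ all q xs
all-map p q h eq xs = cong (foldr _∧_ true)
  (trans (sym (List.map-∘ xs)) (List.map-cong eq xs))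

tribes-suc : ∀ w r m (P : Vec Bool w) (Y : Vec Bool (arity w r m)) →
             tribes w r (suc m) (P ++ Y) ≡ allTrue P ∨ tribes w r m Y
tribes-suc w r m P Y = cong₂ _∨_
  (all-map _ _ (_↑ˡ arity w r m) (Vec.lookup-++ˡ P Y) (allFin w))
  (any-map _ _ (map (w ↑ʳ_)) (all-map _ _ (w ↑ʳ_) (Vec.lookup-++ʳ P Y)) (blocks w r m))

-- Counting satisfying inputs by a union bound

# : ∀ {n} → BoolFun n → ℕ
# f = ∑ (𝟙 ∘ f)

#-suc : ∀ {n} (f : BoolFun (suc n)) → # f ≡ # (f ∘ (false ∷_)) + # (f ∘ (true ∷_))
#-suc f = ∑-suc (𝟙 ∘ f)

#≤ : ∀ {n} (f : BoolFun n) → # f ≤ 2 ^ n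
#≤ {n} f = subst (# f ≤_) (∑-1 n) (∑-mono (λ X → 𝟙≤1 (f X)))
  where
  𝟙≤1 : ∀ b → 𝟙 b ≤ 1
  𝟙≤1 false = z≤n
  𝟙≤1 true  = s≤s z≤n

#-not : ∀ {n} (f : BoolFun n) → # (not ∘ f) + # f ≡ 2 ^ n
#-not {n} f = begin
  # (not ∘ f) + # f                   ≡⟨ ∑-+ (𝟙 ∘ not ∘ f) (𝟙 ∘ f) ⟨
  ∑ (λ X → 𝟙 (not (f X)) + 𝟙 (f X))   ≡⟨ ∑-cong (λ X → 𝟙-not (f X)) ⟩
  ∑ {n} (λ _ → 1)                     ≡⟨ ∑-1 n ⟩
  2 ^ n                               ∎
  where
  open ≡-Reasoning
  𝟙-not : ∀ b → 𝟙 (not b) + 𝟙 b ≡ 1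
  𝟙-not false = refl
  𝟙-not true  = refl

#-suffix : ∀ w {k} (f : BoolFun (w + k)) (g : BoolFun k) →
           (∀ (P : Vec Bool w) Y → f (P ++ Y) ≡ g Y) → # f ≡ 2 ^ w * # g
#-suffix zero    f g f≡g = trans (∑-cong (λ Y → cong 𝟙 (f≡g [] Y))) (sym (+-identityʳ (# g)))
#-suffix (suc w) f g f≡g = begin
  # f                                      ≡⟨ #-suc f ⟩
  # (f ∘ (false ∷_)) + # (f ∘ (true ∷_))   ≡⟨ cong₂ _+_ (#-suffix w _ g (λ P → f≡g (false ∷ P)))
                                                        (#-suffix w _ g (λ P → f≡g (true ∷ P))) ⟩
  2 ^ w * # g + 2 ^ w * # g                ≡⟨ double (2 ^ w) (# g) ⟩
  2 * 2 ^ w * # g                          ∎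
  where
  open ≡-Reasoning
  double : ∀ a b → a * b + a * b ≡ 2 * a * b
  double = solve-∀

-- The term `2 ^ k` pays for the single all-ones prefix, the other term for `g` under every prefix.
-- In the induction a first bit `false` kills the AND and leaves only `g`; at width 0 the AND is
-- true and the trivial bound suffices.
#-∨-allTrue : ∀ w {k} (f : BoolFun (w + k)) (g : BoolFun k) →
              (∀ (P : Vec Bool w) Y → f (P ++ Y) ≡ allTrue P ∨ g Y) →
              # f ≤ 2 ^ k + 2 ^ w * # g
#-∨-allTrue zero    {k} f g f≡ = ≤-trans (#≤ f) (m≤m+n (2 ^ k) _)
#-∨-allTrue (suc w) {k} f g f≡ = begin
  # f                                         ≡⟨ #-suc f ⟩
  # (f ∘ (false ∷_)) + # (f ∘ (true ∷_))      ≤⟨ +-mono-≤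
    (≤-reflexive (#-suffix w _ g (λ P Y → trans (f≡ (false ∷ P) Y) (cong (_∨ g Y) (allTrue-∷ false P)))))
    (#-∨-allTrue w _ g (λ P Y → trans (f≡ (true ∷ P) Y) (cong (_∨ g Y) (allTrue-∷ true P)))) ⟩
  2 ^ w * # g + (2 ^ k + 2 ^ w * # g)         ≡⟨ collect (2 ^ w) (# g) (2 ^ k) ⟩
  2 ^ k + 2 * 2 ^ w * # g                     ∎
  where
  open ≤-Reasoning
  collect : ∀ a b c → a * b + (c + a * b) ≡ c + 2 * a * b
  collect = solve-∀

-- The union bound: each of the `m` ANDs holds with probability `2 ^ - w`. Denominators are cleared
-- to stay within ℕ.
#-tribes : ∀ w r m → 2 ^ w * # (tribes w r m) ≤ m * 2 ^ arity w r m
#-tribes w r zero = ≤-reflexive (begin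
  2 ^ w * # (tribes w r 0)   ≡⟨ cong (2 ^ w *_) (∑-* {r} 0 (λ _ → 0)) ⟩
  2 ^ w * 0                  ≡⟨ *-zeroʳ (2 ^ w) ⟩
  0                          ∎)
  where open ≡-Reasoning
#-tribes w r (suc m) = begin
  2 ^ w * # (tribes w r (suc m))                  ≤⟨ *-monoʳ-≤ (2 ^ w)
                                                       (#-∨-allTrue w _ (tribes w r m) (tribes-suc w r m)) ⟩
  2 ^ w * (2 ^ k + 2 ^ w * # (tribes w r m))      ≤⟨ *-monoʳ-≤ (2 ^ w) (+-monoʳ-≤ (2 ^ k) (#-tribes w r m)) ⟩
  2 ^ w * (2 ^ k + m * 2 ^ k)                     ≡⟨ regroup (2 ^ w) (2 ^ k) m ⟩
  suc m * (2 ^ w * 2 ^ k)                         ≡⟨ cong (suc m *_) (^-distribˡ-+-* 2 w k) ⟨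
  suc m * 2 ^ (w + k)                             ∎
  where
  open ≤-Reasoning
  k = arity w r m
  regroup : ∀ a b c → a * (b + c * b) ≡ suc c * (a * b)
  regroup = solve-∀

half-tribes-false : ∀ w r m → 2 * m ≤ 2 ^ w →
                    2 ^ arity w r m ≤ 2 * # (not ∘ tribes w r m)
half-tribes-false w r m 2m≤2^w =
  -- Adding `2 * t` to both sides replaces the subtraction of the true inputs from all inputs.
  +-cancelʳ-≤ (2 * t) N (2 * # (not ∘ tribes w r m)) (begin
    N + 2 * t                                   ≤⟨ +-monoʳ-≤ N 2t≤N ⟩
    N + N                                       ≡⟨ double N ⟩
    2 * N                                       ≡⟨ cong (2 *_) (#-not (tribes w r m)) ⟨
    2 * (# (not ∘ tribes w r m) + t)            ≡⟨ *-distribˡ-+ 2 (# (not ∘ tribes w r m)) t ⟩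
    2 * # (not ∘ tribes w r m) + 2 * t          ∎)
  where
  open ≤-Reasoning
  N = 2 ^ arity w r m
  t = # (tribes w r m)

  double : ∀ a → a + a ≡ 2 * a
  double = solve-∀

  swap : ∀ a b c → a * (b * c) ≡ b * (a * c)
  swap = solve-∀

  2t≤N : 2 * t ≤ N
  2t≤N = *-cancelˡ-≤ (2 ^ w) {{m^n≢0 2 w}} (begin
    2 ^ w * (2 * t)   ≡⟨ swap (2 ^ w) 2 t ⟩
    2 * (2 ^ w * t)   ≤⟨ *-monoʳ-≤ 2 (#-tribes w r m) ⟩
    2 * (m * N)       ≡⟨ *-assoc 2 m N ⟨
    2 * m * N         ≤⟨ *-monoˡ-≤ N 2m≤2^w ⟩
    2 ^ w * N         ∎)

-- Families of disjoint sensitive blocks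

^^-⊥ : ∀ {n} (X : Vec Bool n) → X ^^ ⊥ ≡ X
^^-⊥ = Vec.zipWith-identityʳ Bool.xor-identityʳ

Empty-⊥∩ : ∀ {n} (p : Subset n) → Empty (⊥ ∩ p)
Empty-⊥∩ p (_ , x∈) = ∉⊥ (p∩q⊆p ⊥ p x∈)

Empty-∩⊥ : ∀ {n} (p : Subset n) → Empty (p ∩ ⊥)
Empty-∩⊥ p (_ , x∈) = ∉⊥ (p∩q⊆q p ⊥ x∈)

Empty-++ : ∀ {w k} (p : Subset w) {q : Subset k} → Empty p → Empty q → Empty (p ++ q)
Empty-++ []      ¬p ¬q x                  = ¬q x
Empty-++ (_ ∷ p) ¬p ¬q (zero  , here)     = ¬p (zero , here)
Empty-++ (_ ∷ p) ¬p ¬q (suc i , there x∈) =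
  Empty-++ p (λ (j , j∈) → ¬p (suc j , there j∈)) ¬q (i , x∈)

Empty-++-∩ : ∀ {w k} (p p′ : Subset w) (q q′ : Subset k) →
             Empty (p ∩ p′) → Empty (q ∩ q′) → Empty ((p ++ q) ∩ (p′ ++ q′))
Empty-++-∩ p p′ q q′ ¬p ¬q =
  subst Empty (sym (Vec.zipWith-++ _∧_ p q p′ q′)) (Empty-++ (p ∩ p′) ¬p ¬q)

pad : ∀ w {k} → Subset k → Subset (w + k)
pad w B = ⊥ {w} ++ B

pad-sensitive : ∀ {w k l} (f : BoolFun (w + k)) (P : Vec Bool w) (Y : Vec Bool k)
                (Bs : Vec (Subset k) l) → SensitiveBlocks (f ∘ (P ++_)) Y Bs →
                SensitiveBlocks f (P ++ Y) (Vec.map (pad w) Bs)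
pad-sensitive {w} f P Y Bs (disj , sens) = disj′ , sens′
  where
  disj′ : ∀ i j → i ≢ j →
          Empty (lookup (Vec.map (pad w) Bs) i ∩ lookup (Vec.map (pad w) Bs) j)
  disj′ i j i≢j rewrite Vec.lookup-map i (pad w) Bs | Vec.lookup-map j (pad w) Bs =
    Empty-++-∩ ⊥ ⊥ _ _ (Empty-∩⊥ ⊥) (disj i j i≢j)

  sens′ : ∀ i → f ((P ++ Y) ^^ lookup (Vec.map (pad w) Bs) i) ≢ f (P ++ Y)
  sens′ i rewrite Vec.lookup-map i (pad w) Bs
                | Vec.zipWith-++ _xor_ P Y ⊥ (lookup Bs i)
                | ^^-⊥ P = sens i

-- The induction step for `tribes-sensitive`: a sensitive block `A` inside the prefix is disjoint
-- from all blocks of the suffix, so the two kinds combine.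
cons-sensitive : ∀ {w k l} (f : BoolFun (w + k)) (P A : Vec Bool w) (Y : Vec Bool k) →
                 f ((P ^^ A) ++ Y) ≢ f (P ++ Y) →
                 HasSensitiveBlocks (f ∘ (P ++_)) Y l →
                 HasSensitiveBlocks f (P ++ Y) (suc l)
cons-sensitive {w} f P A Y sensA (Bs , s) with pad-sensitive f P Y Bs s
... | disj , sens = (A ++ ⊥) ∷ Vec.map (pad w) Bs , disj′ , sens′
  where
  disj′ : ∀ i j → i ≢ j → Empty (lookup ((A ++ ⊥) ∷ Vec.map (pad w) Bs) i ∩
                                 lookup ((A ++ ⊥) ∷ Vec.map (pad w) Bs) j)
  disj′ zero    zero    i≢j = ⊥-elim (i≢j refl)
  disj′ zero    (suc j) i≢j rewrite Vec.lookup-map j (pad w) Bs =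
    Empty-++-∩ A ⊥ ⊥ _ (Empty-∩⊥ A) (Empty-⊥∩ _)
  disj′ (suc i) zero    i≢j rewrite Vec.lookup-map i (pad w) Bs =
    Empty-++-∩ ⊥ A _ ⊥ (Empty-⊥∩ A) (Empty-∩⊥ _)
  disj′ (suc i) (suc j) i≢j = disj i j (i≢j ∘ cong suc)

  sens′ : ∀ i → f ((P ++ Y) ^^ lookup ((A ++ ⊥) ∷ Vec.map (pad w) Bs) i) ≢ f (P ++ Y)
  sens′ zero rewrite Vec.zipWith-++ _xor_ P Y A ⊥ | ^^-⊥ Y = sensA
  sens′ (suc i) = sens i

-- By contraposition, a flip that changes `f` at `Y` also changes `g`. This carries blocks over when
-- `f` and `g` agree only up to an equality or an injective relabelling of values.
sensitive-map : ∀ {k l} {f g : BoolFun k} (Y : Vec Bool k) →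
                (∀ Z → g Z ≡ g Y → f Z ≡ f Y) →
                HasSensitiveBlocks f Y l → HasSensitiveBlocks g Y l
sensitive-map Y f⇐g (Bs , disj , sens) = Bs , disj , λ i eq → sens i (f⇐g _ eq)

tribes-sensitive : ∀ w r m (Y : Vec Bool (arity w r m)) → tribes w r m Y ≡ false →
                   HasSensitiveBlocks (tribes w r m) Y m
tribes-sensitive w r zero    Y _ = [] , (λ ()) , (λ ())
tribes-sensitive w r (suc m) X X₀ with splitAt w X
... | P , Y , refl = cons-sensitive (tribes w r (suc m)) P (∁ P) Y flips
    (sensitive-map Y (λ Z eq → trans (sym (tail Z)) (trans eq (tail Y)))
      (tribes-sensitive w r m Y Y₀))
  where
  both : allTrue P ∨ tribes w r m Y ≡ false
  both = trans (sym (tribes-suc w r m P Y)) X₀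

  P₀ : allTrue P ≡ false
  P₀ = Bool.∨-conicalˡ _ _ both

  Y₀ : tribes w r m Y ≡ false
  Y₀ = Bool.∨-conicalʳ (allTrue P) _ both

  -- The first AND is false on `P`, so with this prefix fixed only the remaining blocks matter and
  -- the induction hypothesis applies.
  tail : ∀ Z → tribes w r (suc m) (P ++ Z) ≡ tribes w r m Z
  tail Z = trans (tribes-suc w r m P Z) (cong (_∨ tribes w r m Z) P₀)

  flipped : tribes w r (suc m) ((P ^^ ∁ P) ++ Y) ≡ true
  flipped = trans (tribes-suc w r m (P ^^ ∁ P) Y)
                  (cong (_∨ tribes w r m Y) (allTrue-^^-∁ P))

  flips : tribes w r (suc m) ((P ^^ ∁ P) ++ Y) ≢ tribes w r (suc m) (P ++ Y)
  flips eq with trans (sym flipped) (trans eq X₀)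
  ... | ()

-- Balancing by XOR with a fresh bit

toggle : ∀ {n} → BoolFun n → BoolFun (suc n)
toggle g (x ∷ Y) = x xor g Y

xor-cancelˡ : ∀ x {y z} → x xor y ≡ x xor z → y ≡ z
xor-cancelˡ false eq = eq
xor-cancelˡ true  eq = Bool.not-injective eq

toggle-sensitive : ∀ {n k} (g : BoolFun n) x Y →
                   HasSensitiveBlocks g Y k → HasSensitiveBlocks (toggle g) (x ∷ Y) k
toggle-sensitive g x Y h
  with sensitive-map {g = toggle g ∘ (x ∷_)} Y (λ Z → xor-cancelˡ x) h
... | Bs , s = Vec.map (pad 1) Bs , pad-sensitive (toggle g) (x ∷ []) Y Bs s

#-toggle : ∀ {n} (g : BoolFun n) → # (toggle g) ≡ 2 ^ n
#-toggle g = trans (#-suc (toggle g))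
  (trans (+-comm (# g) (# (not ∘ g))) (#-not g))

-- For each `Y` exactly one value of the first bit produces `b`.
length-fibre-toggle : ∀ {n} (g : BoolFun n) b → length (fibre (toggle g) b) ≡ 2 ^ n
length-fibre-toggle {n} g b = begin
  length (fibre (toggle g) b)                         ≡⟨ length-fibre (toggle g) b ⟩
  ∑ (λ X → [ toggle g X ])                            ≡⟨ ∑-suc (λ X → [ toggle g X ]) ⟩
  ∑ (λ Y → [ g Y ]) + ∑ (λ Y → [ not (g Y) ])         ≡⟨ ∑-+ (λ Y → [ g Y ]) (λ Y → [ not (g Y) ]) ⟨
  ∑ (λ Y → [ g Y ] + [ not (g Y) ])                   ≡⟨ ∑-cong (λ Y → one b (g Y)) ⟩
  ∑ {n} (λ _ → 1)                                     ≡⟨ ∑-1 n ⟩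
  2 ^ n                                               ∎
  where
  open ≡-Reasoning
  [_] : Bool → ℕ
  [ y ] = 𝟙 (does (y Bool.≟ b))

  one : ∀ b y → 𝟙 (does (y Bool.≟ b)) + 𝟙 (does (not y Bool.≟ b)) ≡ 1
  one false false = refl
  one false true  = refl
  one true  false = refl
  one true  true  = refl

-- If `g Y` is false then `b xor g Y` is `b`, so `b ∷ Y` lies in the fibre over `b` and inherits the
-- `m` blocks of `Y`. All other points of the fibre are bounded below by 0.
sum-bs-toggle : ∀ {n m} (g : BoolFun n) b →
                (∀ Y → g Y ≡ false → HasSensitiveBlocks g Y m) →
                m * # (not ∘ g) ≤ sum (map (bs (toggle g)) (fibre (toggle g) b))
sum-bs-toggle {n} {m} g b sens = begin
  m * # (not ∘ g)                                      ≡⟨ ∑-* m (𝟙 ∘ not ∘ g) ⟨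
  ∑ (λ Y → m * 𝟙 (not (g Y)))                          ≤⟨ ∑-mono pointwise ⟩
  ∑ (λ Y → h (b ∷ Y))                                  ≤⟨ half b ⟩
  ∑ (λ Y → h (false ∷ Y)) + ∑ (λ Y → h (true ∷ Y))     ≡⟨ ∑-suc h ⟨
  ∑ h                                                  ≡⟨ sum-fibre (toggle g) b (bs (toggle g)) ⟨
  sum (map (bs (toggle g)) (fibre (toggle g) b))       ∎
  where
  open ≤-Reasoning
  h : Vec Bool (suc n) → ℕ
  h X = if does (toggle g X Bool.≟ b) then bs (toggle g) X else 0

  half : ∀ x → ∑ (λ Y → h (x ∷ Y)) ≤ ∑ (λ Y → h (false ∷ Y)) + ∑ (λ Y → h (true ∷ Y))
  half false = m≤m+n _ _
  half true  = m≤n+m _ _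

  if-≤ : ∀ b t {s} → (t ≡ false → m ≤ s) →
         m * 𝟙 (not t) ≤ (if does ((b xor t) Bool.≟ b) then s else 0)
  if-≤ b     true  _   = ≤-trans (≤-reflexive (*-zeroʳ m)) z≤n
  if-≤ false false m≤s = ≤-trans (≤-reflexive (*-identityʳ m)) (m≤s refl)
  if-≤ true  false m≤s = ≤-trans (≤-reflexive (*-identityʳ m)) (m≤s refl)

  pointwise : ∀ Y → m * 𝟙 (not (g Y)) ≤ h (b ∷ Y)
  pointwise Y = if-≤ b (g Y) λ gY≡false →
    bs-maximal (toggle g) (b ∷ Y) (toggle-sensitive g b Y (sens Y gY≡false))

-- From counts to rational averages

ratio-*-≤ : ∀ {a b p q m d} → 0 < b → 0 < q → 0 < d →
            a * p * d ≤ m * (b * q) → ratio a b ℚ.* ratio p q ℚ.≤ ratio m d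
-- Unnormalised fractions turn the claim into cross-multiplication, free of gcds.
ratio-*-≤ {a} {suc b} {p} {suc q} {m} {suc d} _ _ _ le = ℚ.toℚᵘ-cancel-≤ (begin
  ℚ.toℚᵘ (ratio a (suc b) ℚ.* ratio p (suc q))             ≃⟨ ℚ.toℚᵘ-homo-* (ratio a (suc b)) (ratio p (suc q)) ⟩
  ℚ.toℚᵘ (ratio a (suc b)) ℚᵘ.* ℚ.toℚᵘ (ratio p (suc q))   ≃⟨ ℚᵘ.*-cong (ℚ.toℚᵘ-fromℚᵘ (mkℚᵘ (ℤ.+ a) b))
                                                                         (ℚ.toℚᵘ-fromℚᵘ (mkℚᵘ (ℤ.+ p) q)) ⟩
  mkℚᵘ (ℤ.+ a) b ℚᵘ.* mkℚᵘ (ℤ.+ p) q                       ≤⟨ *≤* le′ ⟩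
  mkℚᵘ (ℤ.+ m) d                                           ≃⟨ ℚ.toℚᵘ-fromℚᵘ (mkℚᵘ (ℤ.+ m) d) ⟨
  ℚ.toℚᵘ (ratio m (suc d))                                 ∎)
  where
  open ℚᵘ.≤-Reasoning
  le′ : (ℤ.+ a ℤ.* ℤ.+ p) ℤ.* ℤ.+ suc d ℤ.≤ ℤ.+ m ℤ.* ℤ.+ (suc b * suc q)
  le′ = subst₂ ℤ._≤_
    (trans (ℤ.pos-* (a * p) (suc d)) (cong (ℤ._* ℤ.+ suc d) (ℤ.pos-* a p)))
    (ℤ.pos-* m (suc b * suc q)) (ℤ.+≤+ le)

ratio-half : ∀ {k} → 0 < k → ratio k (2 * k) ≡ ½
ratio-half {suc k} _ = ℚ.fromℚᵘ-cong {mkℚᵘ (ℤ.+ suc k) _} {mkℚᵘ (ℤ.+ 1) 1}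
  (ℚᵘ.*≡* (trans (sym (ℤ.pos-* (suc k) 2))
                 (trans (cong ℤ.+_ (*-comm (suc k) 2))
                        (sym (ℤ.*-identityˡ (ℤ.+ (2 * suc k)))))))

mean-toggle : ∀ {n} (g : BoolFun n) → mean (toggle g) ≡ ½
mean-toggle {n} g =
  trans (cong₂ ratio (#-toggle g) (length-cube (suc n))) (ratio-half (m^n>0 2 n))

-- The constant 1/8 combines a factor 1/2, for the part of the fibre where the ORed ANDs vanish,
-- with the 1/4 lost in `n ≤ 4 * (m * L)`.
avgBs-toggle-tribes : ∀ w r m b L → 2 * m ≤ 2 ^ w →
  let n = suc (arity w r m) in n ≤ 4 * (m * L) →
  ratio 1 8 ℚ.* ratio n L ℚ.≤ avgBs b (toggle (tribes w r m))
-- For `L = 0` the hypothesis would bound a successor by 0.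
avgBs-toggle-tribes w r m b zero _ n≤ with subst (suc (arity w r m) ≤_) (cong (4 *_) (*-zeroʳ m)) n≤
... | ()
avgBs-toggle-tribes w r m b L@(suc _) 2m≤2^w n≤
  rewrite length-fibre-toggle (tribes w r m) b =
  ratio-*-≤ {1} {8} {n} {L} (s≤s z≤n) (s≤s z≤n) (m^n>0 2 (arity w r m)) (begin
    1 * n * 2 ^ arity w r m            ≡⟨ cong (_* 2 ^ arity w r m) (*-identityˡ n) ⟩
    n * 2 ^ arity w r m                ≤⟨ *-mono-≤ n≤ (half-tribes-false w r m 2m≤2^w) ⟩
    4 * (m * L) * (2 * z)              ≡⟨ regroup m L z ⟩
    m * z * (8 * L)                    ≤⟨ *-monoˡ-≤ (8 * L)
                                            (sum-bs-toggle (tribes w r m) b (tribes-sensitive w r m)) ⟩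
    S * (8 * L)                        ∎)
  where
  open ≤-Reasoning
  n = suc (arity w r m)
  z = # (not ∘ tribes w r m)
  S = sum (map (bs (toggle (tribes w r m))) (fibre (toggle (tribes w r m)) b))
  regroup : ∀ a b c → 4 * (a * b) * (2 * c) ≡ a * c * (8 * b)
  regroup = solve-∀

-- The depth-three circuit

andLayer : ∀ {n s} → Gates n s → (Bs : List (List (Fin n))) → Gates n (length Bs + s)
andLayer         G []       = G
-- The shift by `length Bs + s` passes over every gate, so each AND reads input wires only.
andLayer {s = s} G (B ∷ Bs) = andLayer G Bs ▹ AND (map ((length Bs + s) ↑ʳ_) B)

outputs : ∀ {n s} (Bs : List (List (Fin n))) → List (Fin (length Bs + s + n))
outputs []       = []
outputs (B ∷ Bs) = zero ∷ map suc (outputs Bs)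

earlier : ∀ {n s} (Bs : List (List (Fin n))) → Fin (s + n) → Fin (length Bs + s + n)
earlier []       i = i
earlier (B ∷ Bs) i = suc (earlier Bs i)

module _ {n} (X : Vec Bool n) where

  input-value : ∀ {s} (G : Gates n s) i → lookup (wireValues G X) (s ↑ʳ i) ≡ lookup X i
  input-value inputs  i = refl
  input-value (G ▹ g) i = input-value G i

  earlier-value : ∀ {s} (G : Gates n s) Bs i →
                  lookup (wireValues (andLayer G Bs) X) (earlier Bs i) ≡ lookup (wireValues G X) i
  earlier-value G []       i = refl
  earlier-value G (B ∷ Bs) i = earlier-value G Bs i

  outputs-value : ∀ {s} (G : Gates n s) Bs →
                  any (lookup (wireValues (andLayer G Bs) X)) (outputs Bs) ≡ dnf Bs X
  outputs-value G []       = refl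
  outputs-value G (B ∷ Bs) = cong₂ _∨_
    (all-map _ _ _ (input-value (andLayer G Bs)) B)
    (trans (any-map _ _ suc (λ _ → refl) (outputs Bs)) (outputs-value G Bs))

maxDepth : ∀ {A : Set} → (A → ℕ) → List A → ℕ
maxDepth d is = foldr _⊔_ 0 (map d is)

maxDepth≤ : ∀ {A : Set} {b} (d : A → ℕ) → (∀ i → d i ≤ b) → ∀ is → maxDepth d is ≤ b
maxDepth≤ d d≤ []       = z≤n
maxDepth≤ d d≤ (i ∷ is) = ⊔-lub (d≤ i) (maxDepth≤ d d≤ is)

input-depth : ∀ {n s} (G : Gates n s) i → lookup (wireDepths G) (s ↑ʳ i) ≡ 0
input-depth inputs  i = Vec.lookup-replicate i 0
input-depth (G ▹ g) i = input-depth G i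

earlier-depth : ∀ {n s} (G : Gates n s) Bs i →
                lookup (wireDepths (andLayer G Bs)) (earlier Bs i) ≡ lookup (wireDepths G) i
earlier-depth G []       i = refl
earlier-depth G (B ∷ Bs) i = earlier-depth G Bs i

-- The new ANDs read only inputs, which have depth 0, so the depth of `G` does not enter. Hence a
-- second layer can be listed after the first without adding depth.
outputs-depth : ∀ {n s} (G : Gates n s) Bs →
                maxDepth (lookup (wireDepths (andLayer G Bs))) (outputs Bs) ≤ 1
outputs-depth G []       = z≤n
outputs-depth {s = s} G (B ∷ Bs) = ⊔-lub
  (s≤s (subst (_≤ 0) (cong (foldr _⊔_ 0) (List.map-∘ B))
    (maxDepth≤ _ (λ i → ≤-reflexive (input-depth (andLayer G Bs) i)) B)))
  (subst (_≤ 1) (cong (foldr _⊔_ 0) (List.map-∘ (outputs Bs))) (outputs-depth G Bs))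

-- Distributivity, term by term: the conjunction with `x` is absorbed into the existing ANDs and
-- costs no further layer.
dnf-∧ : ∀ {n} x (Y : Vec Bool n) Bs →
        dnf (map (λ B → zero ∷ map suc B) Bs) (x ∷ Y) ≡ x ∧ dnf Bs Y
dnf-∧ x Y []       = sym (Bool.∧-zeroʳ x)
dnf-∧ x Y (B ∷ Bs) = trans
  (cong₂ _∨_ (cong (x ∧_) (all-map (lookup (x ∷ Y)) (lookup Y) suc (λ _ → refl) B))
             (dnf-∧ x Y Bs))
  (sym (Bool.∧-distribˡ-∨ x (all (lookup Y) B) (dnf Bs Y)))

-- x xor T = (x ∨ T) ∧ ¬ (x ∧ T), and x ∧ T is again a DNF: x joins each term.
module ToggleCircuit {n} (Bs : List (List (Fin n))) where

  Bs₁ Bs₂ : List (List (Fin (suc n)))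
  Bs₁ = map (map suc) Bs
  Bs₂ = map (λ B → zero ∷ map suc B) Bs

  layer₁ : Gates (suc n) (length Bs₁ + 0)
  layer₁ = andLayer inputs Bs₁

  -- The last gate computes `x ∨ T`, with the OR reading the input wire of `x` next to the terms.
  G₁ : Gates (suc n) (suc (length Bs₁ + 0))
  G₁ = layer₁ ▹ OR (((length Bs₁ + 0) ↑ʳ zero) ∷ outputs Bs₁)

  -- The last gate computes `x ∧ T`, from a fresh layer of ANDs.
  G₂ : Gates (suc n) (suc (length Bs₂ + suc (length Bs₁ + 0)))
  G₂ = andLayer G₁ Bs₂ ▹ OR (outputs Bs₂)

  toggleCircuit : Circuit (suc n)
  toggleCircuit = circuit _
    -- Here `zero` is the negated `x ∧ T`; the two `suc`s skip the NOT gate and the OR below it, and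
    -- `earlier Bs₂ zero` is the gate for `x ∨ T`.
    ((G₂ ▹ NOT zero) ▹ AND (zero ∷ suc (suc (earlier Bs₂ zero)) ∷ [])) zero

  eval-toggleCircuit : ∀ X → eval toggleCircuit X ≡ toggle (dnf Bs) X
  eval-toggleCircuit X@(x ∷ Y)
    rewrite outputs-value X G₁ Bs₂
          | earlier-value X G₁ Bs₂ zero
          | input-value X layer₁ zero
          | outputs-value X inputs Bs₁
          | any-map (all (lookup X)) (all (lookup Y)) (map suc)
              (all-map (lookup X) (lookup Y) suc (λ _ → refl)) Bs
          | dnf-∧ x Y Bs
    = xor-as-∧ x (dnf Bs Y)
    where
    xor-as-∧ : ∀ x t → not (x ∧ t) ∧ ((x ∨ t) ∧ true) ≡ x xor t
    xor-as-∧ false false = refl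
    xor-as-∧ false true  = refl
    xor-as-∧ true  false = refl
    xor-as-∧ true  true  = refl

  depth-toggleCircuit : depth toggleCircuit ≤ 3
  -- NOT adds no depth, so both wires read by the final AND have depth at most 2.
  depth-toggleCircuit = s≤s (⊔-lub (s≤s (outputs-depth G₁ Bs₂))
    (⊔-lub (subst (_≤ 2) (sym (earlier-depth G₁ Bs₂ zero))
      (s≤s (⊔-lub (subst (_≤ 1) (sym (input-depth layer₁ zero)) z≤n) (outputs-depth inputs Bs₁))))
      z≤n))

  size-toggleCircuit : size toggleCircuit ≡ 2 * length Bs + 4
  size-toggleCircuit = trans
    (cong₂ (λ l₁ l₂ → 3 + (l₂ + suc (l₁ + 0))) (List.length-map _ Bs) (List.length-map _ Bs))
    (total (length Bs))
    where
    total : ∀ l → 3 + (l + suc (l + 0)) ≡ 2 * l + 4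
    total = solve-∀

-- Choice of parameters for every length

record Solution (n : ℕ) : Set where
  field
    fun        : BoolFun n
    balanced   : n ≥ 1 → mean fun ≡ ½
    circ       : Circuit n
    eval-circ  : ∀ X → eval circ X ≡ fun X
    depth-circ : depth circ ≤ 3
    size-circ  : n ≥ 4 → size circ ≤ n ^ 2
    avg        : ∀ b → n ≥ 4 → ratio 1 8 ℚ.* n/log n ℚ.≤ avgBs b fun

open Solution

-- Matching the length equation with `refl` once, for the whole record, lets all fields speak of the
-- same function without transport.
tribesSolution : ∀ {n} w r m → n ≡ suc (arity w r m) → m ≤ n → 2 * m ≤ 2 ^ w →
                 (n ≥ 4 → n ≤ 4 * (m * ⌊log₂ n ⌋)) → Solution n
tribesSolution {n} w r m refl m≤n 2m≤2^w n≤ = record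
  { fun        = toggle (tribes w r m)
  ; balanced   = λ _ → mean-toggle (tribes w r m)
  ; circ       = toggleCircuit
  ; eval-circ  = eval-toggleCircuit
  ; depth-circ = depth-toggleCircuit
  ; size-circ  = λ n≥4 → begin
      size toggleCircuit               ≡⟨ size-toggleCircuit ⟩
      2 * length (blocks w r m) + 4    ≡⟨ cong (λ l → 2 * l + 4) (length-blocks w r m) ⟩
      2 * m + 4                        ≤⟨ +-mono-≤ (*-monoʳ-≤ 2 m≤n) n≥4 ⟩
      2 * n + n                        ≡⟨ +-comm (2 * n) n ⟩
      3 * n                            ≤⟨ *-monoˡ-≤ n (≤-trans (n≤1+n 3) n≥4) ⟩
      n * n                            ≡⟨ cong (n *_) (*-identityʳ n) ⟨
      n ^ 2                            ∎
  ; avg        = λ b n≥4 → avgBs-toggle-tribes w r m b ⌊log₂ n ⌋ 2m≤2^w (n≤ n≥4)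
  }
  where
  open ToggleCircuit (blocks w r m)
  open ≤-Reasoning

n<2^[1+⌊log₂n⌋] : ∀ n → n < 2 ^ suc ⌊log₂ n ⌋
n<2^[1+⌊log₂n⌋] n = ≰⇒> λ 2^w≤n → 1+n≰n
  (subst (_≤ ⌊log₂ n ⌋) (⌊log₂[2^n]⌋≡n (suc ⌊log₂ n ⌋)) (⌊log₂⌋-mono-≤ 2^w≤n))

-- Ensures that a block of width `suc ⌊log₂ n ⌋` fits beside the toggle bit, so that there is at
-- least one block.
2+⌊log₂n⌋≤n : ∀ {n} → n ≥ 4 → 2 + ⌊log₂ n ⌋ ≤ n
2+⌊log₂n⌋≤n {n} n≥4 with m≤n⇒∃[o]m+o≡n n≥4
... | k , refl = s≤s (s≤s (subst (⌊log₂ (4 + k) ⌋ ≤_) (⌊log₂[2^n]⌋≡n (2 + k))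
                   (⌊log₂⌋-mono-≤ (4+k≤2^[2+k] k))))
  where
  4+k≤2^[2+k] : ∀ k → 4 + k ≤ 2 ^ (2 + k)
  4+k≤2^[2+k] zero    = ≤-refl
  4+k≤2^[2+k] (suc k) = +-mono-≤ (m^n>0 2 (2 + k))
    (≤-trans (4+k≤2^[2+k] k) (m≤m+n (2 ^ (2 + k)) 0))

solution : ∀ n → Solution n
-- Length 0 has no bit to toggle. The empty OR gives the constant `false`, and the balance, size and
-- average fields are vacuous.
solution zero = record
  { fun        = λ _ → false
  ; balanced   = λ ()
  ; circ       = circuit 1 (inputs ▹ OR []) zero
  ; eval-circ  = λ _ → refl
  ; depth-circ = s≤s z≤n
  ; size-circ  = λ ()
  ; avg        = λ _ ()
  }
solution n@(suc N) =
  tribesSolution w r m (cong suc (trans N≡ (sym (arity≡ w r m))))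
    (≤-trans (m≤m*n m w) (≤-trans mw≤N (n≤1+n N)))
    (2m≤2^w L (≤-trans (s≤s mw≤N) (<⇒≤ n<2^w))) n≤4mL
  where
  L = ⌊log₂ n ⌋
  -- This is the width with `2 ^ w > n`. One bit is reserved for the toggle; the other `N` are
  -- divided into `m` blocks with remainder `r`.
  w = suc L
  r = N % w
  m = N / w

  N≡ : N ≡ r + m * w
  N≡ = m≡m%n+[m/n]*n N w

  mw≤N : m * w ≤ N
  mw≤N = subst (m * w ≤_) (sym N≡) (m≤n+m (m * w) r)

  n<2^w : n < 2 ^ w
  n<2^w = n<2^[1+⌊log₂n⌋] n

  -- For width at least 2, `2 * m` is at most the total block length, which is below `2 ^ w`. Width
  -- 1 is separate: there the hypothesis forces `m ≤ 1`.
  2m≤2^w : ∀ L → suc (m * suc L) ≤ 2 ^ suc L → 2 * m ≤ 2 ^ suc L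
  2m≤2^w zero    le = *-monoʳ-≤ 2 (≤-trans (≤-reflexive (sym (*-identityʳ m))) (s≤s⁻¹ le))
  2m≤2^w (suc L) le = begin
    2 * m                 ≡⟨ *-comm 2 m ⟩
    m * 2                 ≤⟨ *-monoʳ-≤ m (s≤s (s≤s z≤n)) ⟩
    m * suc (suc L)       ≤⟨ n≤1+n _ ⟩
    suc (m * suc (suc L)) ≤⟨ le ⟩
    2 ^ suc (suc L)       ∎
    where open ≤-Reasoning

  n≤[1+m]w : n ≤ suc m * w
  n≤[1+m]w = subst (λ k → suc k ≤ w + m * w) (sym N≡) (+-monoˡ-≤ (m * w) (m%n<n N w))

  -- For `m` and `L` at least 1, each of `suc m` and `suc L` at most doubles, whence the factor 4.
  -- The case `m = 0` would give `2 + L ≤ n ≤ 1 + L`, and `L = 0` would give `n < 2`.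
  quadruple : ∀ {n} m L → n ≤ suc m * suc L → 2 + L ≤ n → n < 2 ^ suc L → n ≥ 4 →
              n ≤ 4 * (m * L)
  quadruple zero    L       n≤ 2+L≤n _ _ =
    contradiction (≤-trans 2+L≤n (≤-trans n≤ (≤-reflexive (*-identityˡ (suc L))))) 1+n≰n
  quadruple (suc m) zero    _ _ n<2 n≥4 =
    contradiction (≤-trans n≥4 (s≤s⁻¹ n<2)) λ { (s≤s ()) }
  quadruple (suc m) (suc L) n≤ _ _ _ = ≤-trans n≤
    (≤-trans (m≤m+n _ (3 * (m * L) + 2 * m + 2 * L)) (≤-reflexive (expand m L)))
    where
    expand : ∀ m L → (2 + m) * (2 + L) + (3 * (m * L) + 2 * m + 2 * L) ≡
                     4 * (suc m * suc L)
    expand = solve-∀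

  n≤4mL : n ≥ 4 → n ≤ 4 * (m * L)
  n≤4mL n≥4 = quadruple m L n≤[1+m]w (2+⌊log₂n⌋≤n n≥4) n<2^w n≥4

theorem17 : Σ Family λ f →
    ReasonablyBalanced f ×
    AC⁰-computable 3 f ×
    (λ n → avgBs false (f n)) ∈Ω n/log ×
    (λ n → avgBs true (f n)) ∈Ω n/log
theorem17 =
  (λ n → fun (solution n)) ,
  (½ , ½ , (0<½ , ½<1) , (0<½ , ½<1) , λ n n≥1 →
    ℚ.≤-reflexive (sym (balanced (solution n) n≥1)) ,
    ℚ.≤-reflexive (balanced (solution n) n≥1)) ,
  ((λ n → circ (solution n)) ,
   (λ n → eval-circ (solution n)) ,
   (λ n → depth-circ (solution n)) ,
   (2 , 4 , λ n → size-circ (solution n))) ,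
  (ratio 1 8 , 0<⅛ , 4 , λ n → avg (solution n) false) ,
  (ratio 1 8 , 0<⅛ , 4 , λ n → avg (solution n) true)
  where
  0<½ : 0ℚ ℚ.< ½
  0<½ = from-yes (0ℚ ℚ.<? ½)

  ½<1 : ½ ℚ.< 1ℚ
  ½<1 = from-yes (½ ℚ.<? 1ℚ)

  0<⅛ : 0ℚ ℚ.< ratio 1 8
  0<⅛ = from-yes (0ℚ ℚ.<? ratio 1 8)
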